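{- Let $n\ge0$ and $k$ be integers, and for integers $a,b$ with $a\equiv b\pmod 2$ set $$S(a,b)=\sum_{i=0}^{\frac{a-|b|}{2}}\binom{\frac{a-|b|}{2}-i}{i}\binom{\frac{a-|b|}{2}-i}{|b|+i}.$$ (1) If $n\equiv k\pmod2$ and $(n,k)\neq(0,0)$, then $|\mathcal{Z}_{n,k}|=2S(n,k)$. (2) If $n\not\equiv k\pmod 2$, then $$|\mathcal{Z}_{n,k}|=|\mathcal{Z}_{n-1,k-2}^+|+|\mathcal{Z}_{n-2,k-1}^+|+|\mathcal{Z}_{n-1,k+2}^-|+|\mathcal{Z}_{n-2,k+1}^-|,$$ where each of the four terms on the right is given by the formula without the factor $2$, i.e. $|\mathcal{Z}_{a,b}^{+}|=S(a,b)$ and $|\mathcal{Z}_{a,b}^{ - }|=S(a,b)$ for the respective indices $(a,b)$.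
   Context: A grand zigzag knight's path is a lattice path in $\mathbb{Z}^2$ starting at the origin, made of steps $N=(1,2)$, $\bar N=(1,-2)$, $E=(2,1)$, $\bar E=(2,-1)$, such that the vertical components of two consecutive steps never have the same direction (up-steps $N,E$ and down-steps $\bar N,\bar E$ alternate). The size is the $x$-coordinate and the altitude the $y$-coordinate of the last point. $\mathcal{Z}_{n,k}$ is the set of grand zigzag knight's paths of size $n$ and altitude $k$ (empty if $n<0$), and $\mathcal{Z}_{n,k}^+$ (resp. $\mathcal{Z}_{n,k}^-$) is its subset of paths starting with $E$ or $N$ (resp. with $\bar E$ or $\bar N$), with the convention that the empty path belongs to both $\mathcal{Z}_{0,0}^+$ and $\mathcal{Z}_{0,0}^-$. A sum with upper limit less than its lower limit is $0$, and $\binom{a}{b}=0$ if $b<0$ or $b>a\ge0$. -}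

module Defs where

open import Data.Fin.Base using (Fin)
open import Data.Integer.Base using (ℤ; +_; -[1+_]; 0ℤ; _+_; _-_; _/ℕ_; ∣_∣; sign)
open import Data.Integer.Divisibility using (_∣_)
open import Data.List.Base using (List; []; _∷_; foldr; map; upTo)
open import Data.List.Relation.Unary.Linked using (Linked)
import Data.Nat.Base as ℕ
open ℕ using (ℕ)
open import Data.Nat.Combinatorics using (_C_)
open import Data.Nat.ListAction using (sum)
open import Data.Product.Base using (_×_)
open import Data.Refinement using (Refinement-syntax)
open import Data.Sum.Base using (_⊎_)
open import Data.Unit.Base using (⊤)
open import Function.Bundles using (_↔_)
open import Relation.Binary.PropositionalEquality.Core using (_≡_; _≢_)

data Step : Set where
  N N̄ E Ē : Step

dx : Step → ℤ
dx N = + 1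
dx N̄ = + 1
dx E = + 2
dx Ē = + 2

dy : Step → ℤ
dy N = + 2
dy N̄ = -[1+ 1 ]
dy E = + 1
dy Ē = -[1+ 0 ]

-- Since every path starts at the origin, it is determined by its steps.
Path : Set
Path = List Step

size : Path → ℤ
size = foldr (λ s x → dx s + x) 0ℤ

altitude : Path → ℤ
altitude = foldr (λ s y → dy s + y) 0ℤ

-- dy never vanishes, so its sign is exactly its direction.
Zigzag : Path → Set
Zigzag = Linked (λ s t → sign (dy s) ≢ sign (dy t))

-- The empty path satisfies both of the following predicates.
StartsUp : Path → Set
StartsUp []      = ⊤
StartsUp (s ∷ _) = s ≡ E ⊎ s ≡ N

StartsDown : Path → Set
StartsDown []      = ⊤
StartsDown (s ∷ _) = s ≡ Ē ⊎ s ≡ N̄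

-- The membership proofs in a refinement type are irrelevant, so elements of
-- these types are equal as soon as the underlying paths are.
Z : ℤ → ℤ → Set
Z n k = [ p ∈ Path ∣ Zigzag p × size p ≡ n × altitude p ≡ k ]

Z⁺ : ℤ → ℤ → Set
Z⁺ n k = [ p ∈ Path ∣ (Zigzag p × size p ≡ n × altitude p ≡ k) × StartsUp p ]

Z⁻ : ℤ → ℤ → Set
Z⁻ n k = [ p ∈ Path ∣ (Zigzag p × size p ≡ n × altitude p ≡ k) × StartsDown p ]

HasCard : Set → ℕ → Set
HasCard A m = A ↔ Fin m

infix 4 _≡₂_

_≡₂_ : ℤ → ℤ → Set
a ≡₂ b = + 2 ∣ a - b

-- The sum of f i over 0 ≤ i ≤ u, which is empty when u is negative.
∑₀ : ℤ → (ℕ → ℕ) → ℕ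
∑₀ (+ u)    f = sum (map f (upTo (ℕ.suc u)))
∑₀ -[1+ _ ] f = 0

-- Meaningful for a ≡₂ b, in which case the division by 2 is exact.  In every
-- summand i ≤ h, so h - i is non-negative and ∣ h - + i ∣ is h - i itself.
S : ℤ → ℤ → ℕ
S a b = ∑₀ h λ i → (∣ h - + i ∣ C i) ℕ.* (∣ h - + i ∣ C (∣ b ∣ ℕ.+ i))
  where
  h : ℤ
  h = (a - + ∣ b ∣) /ℕ 2

{-# OPTIONS --safe #-}
module Submission where

-- A zigzag path with 2m steps starting upwards is given by two subsets of an
-- m-element set: the up-steps that are long (E) and the down-steps that are
-- long (Ē).  If i and j are the sizes of these subsets, the path has size
-- 2m + i + j and altitude j - i.  For altitude b ≥ 0 this forces j = b + i and
-- m = (n - b)/2 - i, so the paths with i steps E are counted by the i-th summand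
-- of S n b; exchanging the two subsets handles b < 0, and reflection in the
-- horizontal axis handles the paths starting downwards.  As dx s - dy s is odd
-- for every step s, the number of steps is even exactly when n ≡₂ k; if it is
-- odd, removing one step leads back to the even case.

open import Defs
open import Data.Integer.Base using (ℤ; +_; 0ℤ; _+_; _-_; _≤_)
import Data.Nat.Base as ℕ
open import Data.Product.Base using (_×_; _,_)
open import Relation.Binary.PropositionalEquality.Core using (_≢_)
open import Relation.Nullary.Negation.Core using (¬_)

open import Data.Bool.Base using (Bool; true; false)
import Data.Bool.Properties as Bool
open import Data.Empty using (⊥-elim-irr)
open import Data.Fin.Base using (Fin)
open import Data.Fin.Patterns using (0F)
open import Data.Fin.Properties using (+↔⊎; *↔×)
open import Data.Integer.Base using (-[1+_]; -_; _*_; _/ℕ_; _%ℕ_; ∣_∣; sign)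
open import Data.Integer.Divisibility.Signed
  using (_∣_; divides; ∣ᵤ⇒∣; ∣⇒∣ᵤ; ∣m∣n⇒∣m+n; ∣m+n∣n⇒∣m; _∣?_)
open import Data.Integer.DivMod using (a≡a%ℕn+[a/ℕn]*n; n%ℕd<d)
import Data.Integer.Properties as ℤ
import Algebra.Properties.AbelianGroup ℤ.+-0-abelianGroup as ℤ+
open import Data.Integer.Tactic.RingSolver using (solve-∀)
open import Data.Irrelevant using ([_])
open import Data.List.Base using (List; []; _∷_; length; map; applyUpTo; _∷ʳ_)
open import Data.List.Properties
  using (≡-dec; map-∘; map-cong; map-id; map-upTo; applyUpTo-∷ʳ)
open import Data.List.Relation.Unary.Linked as Linked using ([]; [-]; _∷_)
import Data.List.Relation.Unary.Linked.Properties as Linked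
open import Data.Nat.Base using (ℕ; zero; suc; _∸_; s≤s)
open import Data.Nat.Combinatorics using (_C_; nCk+nC[k+1]≡[n+1]C[k+1])
open import Data.Nat.ListAction using (sum)
open import Data.Nat.ListAction.Properties using (sum-++)
import Data.Nat.Properties as ℕ
open import Data.Product.Base using (proj₁; proj₂; swap; uncurry)
import Data.Product.Properties as Product
open import Data.Product.Function.NonDependent.Propositional using (_×-cong_)
open import Data.Refinement using (Refinement; Refinement-syntax; refine; value-injective; _,_)
open import Data.Sign.Base using (opposite)
import Data.Sign.Base as Sign
import Data.Sign.Properties as Sign
open import Data.Sum.Base using (_⊎_; inj₁; inj₂)
open import Data.Sum.Function.Propositional using (_⊎-cong_)
open import Data.Unit.Base using (tt)
open import Function.Base using (_∘_)
open import Function.Bundles using (_↔_; mk↔ₛ′)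
open import Function.Properties.Inverse using (↔-sym; ↔-trans)
open import Relation.Binary.Definitions using (DecidableEquality)
open import Relation.Binary.PropositionalEquality
  using (_≡_; refl; sym; trans; cong; cong₂; subst; module ≡-Reasoning)
open import Relation.Nullary.Decidable
  using (yes; no; recompute; from-yes; from-no) renaming (map′ to dec-map)
open import Relation.Nullary.Negation.Core using (contradiction)

-- Cardinalities of refinement types

private
  variable
    A B : Set
    P Q : A → Set
    m n : ℕ

empty-card : (∀ a → ¬ P a) → HasCard (Refinement A P) 0
empty-card ¬p = mk↔ₛ′ (λ { (a , [ p ]) → ⊥-elim-irr (¬p a p) }) (λ ()) (λ ())
  (λ { (a , [ p ]) → ⊥-elim-irr (¬p a p) })

⊎-card : HasCard A m → HasCard B n → HasCard (A ⊎ B) (m ℕ.+ n)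
⊎-card α β = ↔-trans (α ⊎-cong β) (↔-sym +↔⊎)

-- Membership proofs are irrelevant, while the inverse laws have to be relevant equations; decidable
-- equality lets `recompute` recover them.
refinement-↔ : DecidableEquality A → DecidableEquality B →
  (f : A → B) (g : B → A) →
  (∀ a → P a → Q (f a)) → (∀ b → Q b → P (g b)) →
  (∀ a → P a → g (f a) ≡ a) → (∀ b → Q b → f (g b) ≡ b) →
  Refinement A P ↔ Refinement B Q
refinement-↔ _≟ᴬ_ _≟ᴮ_ f g to from gf fg = mk↔ₛ′
  (λ { (a , [ p ]) → f a , [ to a p ] })
  (λ { (b , [ q ]) → g b , [ from b q ] })
  (λ { (b , [ q ]) → value-injective (recompute (f (g b) ≟ᴮ b) (fg b q)) })
  (λ { (a , [ p ]) → value-injective (recompute (g (f a) ≟ᴬ a) (gf a p)) })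

refine-↔ : (∀ a → P a → Q a) → (∀ a → Q a → P a) →
  Refinement A P ↔ Refinement A Q
refine-↔ to from = mk↔ₛ′ (refine (to _)) (refine (from _)) (λ _ → refl) (λ _ → refl)

refinement-×-↔ : [ (a , b) ∈ A × B ∣ P a × Q b ] ↔ (Refinement A P × Refinement B Q)
refinement-×-↔ = mk↔ₛ′
  (λ { ((a , b) , [ pq ]) → (a , [ proj₁ pq ]) , (b , [ proj₂ pq ]) })
  (λ { ((a , [ p ]) , (b , [ q ])) → (a , b) , [ p , q ] })
  (λ _ → refl) (λ _ → refl)

-- `applyUpTo` unfolds at the front, whereas counting by fibres splits off the largest value.
sum-applyUpTo-suc : ∀ (c : ℕ → ℕ) n →
  sum (applyUpTo c n) ℕ.+ c n ≡ sum (applyUpTo c (suc n))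
sum-applyUpTo-suc c n = begin
  sum (applyUpTo c n) ℕ.+ c n                ≡⟨ cong (sum (applyUpTo c n) ℕ.+_) (ℕ.+-identityʳ (c n)) ⟨
  sum (applyUpTo c n) ℕ.+ sum (c n ∷ [])     ≡⟨ sum-++ (applyUpTo c n) (c n ∷ []) ⟨
  sum (applyUpTo c n ∷ʳ c n)  ≡⟨ cong sum (applyUpTo-∷ʳ c n) ⟩
  sum (applyUpTo c (suc n))                  ∎
  where open ≡-Reasoning

last-fibre-↔ : (f : A → ℕ) (n : ℕ) →
  [ a ∈ A ∣ P a × f a ℕ.< suc n ] ↔
  ([ a ∈ A ∣ P a × f a ℕ.< n ] ⊎ [ a ∈ A ∣ P a × f a ≡ n ])
last-fibre-↔ {A} {P} f n = mk↔ₛ′ to from to∘from from∘to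
  where
  Whole Front Fibre : Set
  Whole = [ a ∈ A ∣ P a × f a ℕ.< suc n ]
  Front = [ a ∈ A ∣ P a × f a ℕ.< n ]
  Fibre = [ a ∈ A ∣ P a × f a ≡ n ]

  to : Whole → Front ⊎ Fibre
  to (a , [ p ]) with f a ℕ.<? n
  ... | yes fa<n = inj₁ (a , [ proj₁ p , fa<n ])
  ... | no  fa≮n = inj₂ (a , [ proj₁ p , ℕ.≤-antisym (ℕ.≤-pred (proj₂ p)) (ℕ.≮⇒≥ fa≮n) ])

  from : Front ⊎ Fibre → Whole
  from (inj₁ (a , [ p ])) = a , [ proj₁ p , ℕ.m<n⇒m<1+n (proj₂ p) ]
  from (inj₂ (a , [ p ])) = a , [ proj₁ p , s≤s (ℕ.≤-reflexive (proj₂ p)) ]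

  to∘from : ∀ x → to (from x) ≡ x
  to∘from (inj₁ (a , [ p ])) with f a ℕ.<? n
  ... | yes _    = refl
  ... | no  fa≮n = ⊥-elim-irr (fa≮n (proj₂ p))
  to∘from (inj₂ (a , [ p ])) with f a ℕ.<? n
  ... | yes fa<n = ⊥-elim-irr (ℕ.<⇒≢ fa<n (proj₂ p))
  ... | no  _    = refl

  from∘to : ∀ x → from (to x) ≡ x
  from∘to (a , [ p ]) with f a ℕ.<? n
  ... | yes _ = refl
  ... | no  _ = refl

-- Induction on `n`: the fibre over the largest value accounts for the last term of the sum.
fibres-card : (f : A → ℕ) (c : ℕ → ℕ) (n : ℕ) →
  (∀ i → i ℕ.< n → HasCard [ a ∈ A ∣ P a × f a ≡ i ] (c i)) →
  HasCard [ a ∈ A ∣ P a × f a ℕ.< n ] (sum (applyUpTo c n))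
fibres-card f c zero    fibre = empty-card λ { _ (_ , ()) }
fibres-card f c (suc n) fibre = subst (HasCard _) (sum-applyUpTo-suc c n)
  (↔-trans (last-fibre-↔ f n)
    (⊎-card (fibres-card f c n λ i i<n → fibre i (ℕ.m<n⇒m<1+n i<n)) (fibre n ℕ.≤-refl)))

-- Binary words

Word : Set
Word = List Bool

bit : Bool → ℕ
bit false = 0
bit true  = 1

trues : Word → ℕ
trues []      = 0
trues (b ∷ w) = bit b ℕ.+ trues w

Words : ℕ → ℕ → Set
Words m j = [ w ∈ Word ∣ length w ≡ m × trues w ≡ j ]

-- Pascal's rule, by cases on the first letter.
words-pascal : Words (suc m) (suc n) ↔ (Words m n ⊎ Words m (suc n))
words-pascal = mk↔ₛ′
  (λ { ([] , [ p ])          → ⊥-elim-irr (ℕ.0≢1+n (proj₁ p))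
     ; ((true  ∷ w) , [ p ]) → inj₁ (w , [ ℕ.suc-injective (proj₁ p) , ℕ.suc-injective (proj₂ p) ])
     ; ((false ∷ w) , [ p ]) → inj₂ (w , [ ℕ.suc-injective (proj₁ p) , proj₂ p ]) })
  (λ { (inj₁ (w , [ p ])) → true  ∷ w , [ cong suc (proj₁ p) , cong suc (proj₂ p) ]
     ; (inj₂ (w , [ p ])) → false ∷ w , [ cong suc (proj₁ p) , proj₂ p ] })
  (λ { (inj₁ _) → refl ; (inj₂ _) → refl })
  (λ { ([] , [ p ])          → ⊥-elim-irr (ℕ.0≢1+n (proj₁ p))
     ; ((true  ∷ _) , _) → refl
     ; ((false ∷ _) , _) → refl })

words-falses : Words (suc m) 0 ↔ Words m 0
words-falses = mk↔ₛ′
  (λ { ([] , [ p ])          → ⊥-elim-irr (ℕ.0≢1+n (proj₁ p))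
     ; ((true  ∷ w) , [ p ]) → ⊥-elim-irr (ℕ.1+n≢0 (proj₂ p))
     ; ((false ∷ w) , [ p ]) → w , [ ℕ.suc-injective (proj₁ p) , proj₂ p ] })
  (λ { (w , [ p ]) → false ∷ w , [ cong suc (proj₁ p) , proj₂ p ] })
  (λ _ → refl)
  (λ { ([] , [ p ])          → ⊥-elim-irr (ℕ.0≢1+n (proj₁ p))
     ; ((true  ∷ w) , [ p ]) → ⊥-elim-irr (ℕ.1+n≢0 (proj₂ p))
     ; ((false ∷ _) , _) → refl })

words-card : ∀ m j → HasCard (Words m j) (m C j)
words-card zero    zero    = mk↔ₛ′ (λ _ → 0F) (λ _ → [] , [ refl , refl ])
  (λ { 0F → refl ; (Fin.suc ()) })
  (λ { ([] , _) → refl ; ((_ ∷ _) , [ p ]) → ⊥-elim-irr (ℕ.1+n≢0 (proj₁ p)) })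
words-card zero    (suc j) = empty-card λ { [] (_ , ()) ; (_ ∷ _) (() , _) }
words-card (suc m) zero    = ↔-trans words-falses (words-card m zero)
words-card (suc m) (suc j) = subst (HasCard _) (nCk+nC[k+1]≡[n+1]C[k+1] m j)
  (↔-trans words-pascal (⊎-card (words-card m j) (words-card m (suc j))))

-- Pairs of words

-- The long steps of a path of even length: true stands for E in the first word
-- and for Ē in the second.
Pair : Set
Pair = Word × Word

_≟ᴾ_ : DecidableEquality Pair
_≟ᴾ_ = Product.≡-dec (≡-dec Bool._≟_) (≡-dec Bool._≟_)

Balanced : Pair → Set
Balanced (u , v) = length u ≡ length v

-- These are the size and altitude of the woven path. A short up-step followed by a short down-step
-- has width 2 and no net rise; lengthening a step adds 1 to its width and takes 1 from its rise or
-- fall.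
pairSize pairAltitude : Pair → ℤ
pairSize (u , v) = + length u * + 2 + (+ trues u + + trues v)
pairAltitude (u , v) = + trues v - + trues u

IsPair : ℤ → ℤ → Pair → Set
IsPair a b uv = Balanced uv × pairSize uv ≡ a × pairAltitude uv ≡ b

-- IsPair a (+ β) solved for the length and for trues v, where a = β + 2h.
IsNormal : ℤ → ℕ → Pair → Set
IsNormal h β (u , v) =
  Balanced (u , v) × + (length u ℕ.+ trues u) ≡ h × trues v ≡ β ℕ.+ trues u

-- The summand of `S`: the factors place the long up-steps and the long down-steps.
choice : ℤ → ℕ → ℕ → ℕ
choice h β i = (∣ h - + i ∣ C i) ℕ.* (∣ h - + i ∣ C (β ℕ.+ i))

-- Once `i` is fixed, both words have length `h ∸ i` and prescribed numbers of `true`, so they are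
-- chosen independently.
normalPairs-fibre : ∀ h β i → i ℕ.< suc h →
  HasCard [ uv ∈ Pair ∣ IsNormal (+ h) β uv × trues (proj₁ uv) ≡ i ] (choice (+ h) β i)
-- Since `i ≤ h`, the absolute value in `choice` becomes `h ∸ i`.
normalPairs-fibre h β i (s≤s i≤h) rewrite ℤ.m-n≡m⊖n h i | ℤ.⊖-≥ i≤h =
  ↔-trans (refine-↔ to from)
    (↔-trans refinement-×-↔
      (↔-trans (words-card (h ∸ i) i ×-cong words-card (h ∸ i) (β ℕ.+ i)) (↔-sym *↔×)))
  where
  Split : Pair → Set
  Split (u , v) = (length u ≡ h ∸ i × trues u ≡ i) × (length v ≡ h ∸ i × trues v ≡ β ℕ.+ i)

  to : ∀ uv → IsNormal (+ h) β uv × trues (proj₁ uv) ≡ i → Split uv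
  to (u , v) ((bal , refl , tv) , refl) =
    (len , refl) , (trans (sym bal) len , tv)
    where
    len : length u ≡ length u ℕ.+ trues u ∸ trues u
    len = sym (ℕ.m+n∸n≡m (length u) (trues u))

  from : ∀ uv → Split uv → IsNormal (+ h) β uv × trues (proj₁ uv) ≡ i
  from (u , v) ((lu , refl) , (lv , tv)) =
    (trans lu (sym lv) , cong +_ (trans (cong (ℕ._+ i) lu) (ℕ.m∸n+n≡m i≤h)) , tv) , refl

normalPairs-card : ∀ h β → HasCard (Refinement Pair (IsNormal h β)) (∑₀ h (choice h β))
-- A negative `h` is no sum of a length and a number of letters, in accordance with the empty `∑₀`.
normalPairs-card -[1+ _ ] β = empty-card λ { _ (_ , () , _) }
normalPairs-card (+ h)    β = subst (HasCard _) (cong sum (sym (map-upTo (choice (+ h) β) (suc h))))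
  (↔-trans (refine-↔ (λ uv p → p , bound uv p) (λ _ → proj₁))
    (fibres-card (trues ∘ proj₁) (choice (+ h) β) (suc h) (normalPairs-fibre h β)))
  where
  bound : ∀ uv → IsNormal (+ h) β uv → trues (proj₁ uv) ℕ.< suc h
  bound (u , v) (_ , refl , _) = s≤s (ℕ.m≤n+m (trues u) (length u))

-- The altitude gives `trues v`; after substitution the size reads `β` plus twice
-- `length u + trues u`, and cancelling `β` and 2 leaves `h`.
pairs-normalize : ∀ {a h β} → a ≡ + β + h * + 2 →
  Refinement Pair (IsPair a (+ β)) ↔ Refinement Pair (IsNormal h β)
pairs-normalize {a} {h} {β} a≡ = refine-↔ to from
  where
  open ≡-Reasoning
  regroup : ∀ b l s → l * + 2 + (s + (b + s)) ≡ b + (l + s) * + 2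
  regroup = solve-∀
  cancel : ∀ s t → t ≡ (t - s) + s
  cancel = solve-∀
  cancel′ : ∀ s b → (b + s) - s ≡ b
  cancel′ = solve-∀

  to : ∀ uv → IsPair a (+ β) uv → IsNormal h β uv
  to (u , v) (bal , sz , alt) =
    bal , ℤ.*-cancelʳ-≡ _ h (+ 2) (ℤ+.∙-cancelˡ (+ β) _ _ heights) , tv
    where
    tv : trues v ≡ β ℕ.+ trues u
    tv = ℤ.+-injective (trans (cancel (+ trues u) (+ trues v)) (cong (_+ + trues u) alt))
    heights : + β + + (length u ℕ.+ trues u) * + 2 ≡ + β + h * + 2
    heights = begin
      + β + + (length u ℕ.+ trues u) * + 2                 ≡⟨ regroup (+ β) (+ length u) (+ trues u) ⟨
      + length u * + 2 + (+ trues u + + (β ℕ.+ trues u))  ≡⟨ cong (λ t → + length u * + 2 + (+ trues u + + t)) tv ⟨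
      pairSize (u , v)                                     ≡⟨ sz ⟩
      a                                                    ≡⟨ a≡ ⟩
      + β + h * + 2                                        ∎

  from : ∀ uv → IsNormal h β uv → IsPair a (+ β) uv
  from (u , v) (bal , refl , tv) rewrite tv =
    bal , trans (regroup (+ β) (+ length u) (+ trues u)) (sym a≡) , cancel′ (+ trues u) (+ β)

pairs-swap : ∀ {a b} → Refinement Pair (IsPair a b) ↔ Refinement Pair (IsPair a (- b))
pairs-swap {a} {b} = mk↔ₛ′
  (λ { (uv , [ p ]) → swap uv , [ swapped uv p ] })
  (λ { (uv , [ p ]) → swap uv , [ subst (λ c → IsPair a c (swap uv)) (ℤ.neg-involutive b) (swapped uv p) ] })
  (λ _ → refl) (λ _ → refl)
  where
  neg-diff : ∀ s t → s - t ≡ - (t - s)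
  neg-diff = solve-∀

  swapped : ∀ uv {c} → IsPair a c uv → IsPair a (- c) (swap uv)
  swapped (u , v) (bal , sz , alt) =
    sym bal ,
    trans (cong₂ (λ l t → + l * + 2 + t) (sym bal) (ℤ.+-comm (+ trues v) (+ trues u))) sz ,
    trans (neg-diff (+ trues u) (+ trues v)) (cong -_ alt)

-- `b` and `∣ b ∣` have the same parity, so the division by 2 in `S` leaves no remainder.
≡₂⇒halvable : ∀ {a b} → a ≡₂ b → a ≡ + ∣ b ∣ + (a - + ∣ b ∣) /ℕ 2 * + 2
≡₂⇒halvable {a} {b} a≡₂b with (a - + ∣ b ∣) %ℕ 2 | (a - + ∣ b ∣) /ℕ 2
  | a≡a%ℕn+[a/ℕn]*n (a - + ∣ b ∣) 2 | n%ℕd<d (a - + ∣ b ∣) 2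
... | r | q | div | r<2 = trans (cancel a (+ ∣ b ∣)) (cong (λ d → + ∣ b ∣ + d) (exact r r<2 div))
  where
  cancel : ∀ x y → x ≡ y + (x - y)
  cancel = solve-∀
  via : ∀ x y z → x - z ≡ (x - y) + (y - z)
  via = solve-∀

  2∣b-∣b∣ : ∀ b → + 2 ∣ b - + ∣ b ∣
  2∣b-∣b∣ (+ n)    = divides 0ℤ (ℤ.+-inverseʳ (+ n))
  -- For negative `b` the absolute value is `- b`, so the difference is `b` doubled.
  2∣b-∣b∣ -[1+ n ] = divides -[1+ n ] (double -[1+ n ])
    where
    double : ∀ x → x - - x ≡ x * + 2
    double = solve-∀

  2∣a-∣b∣ : + 2 ∣ a - + ∣ b ∣
  2∣a-∣b∣ = subst (+ 2 ∣_) (sym (via a b (+ ∣ b ∣))) (∣m∣n⇒∣m+n {m = a - b} (∣ᵤ⇒∣ a≡₂b) (2∣b-∣b∣ b))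

  exact : ∀ r → r ℕ.< 2 → a - + ∣ b ∣ ≡ + r + q * + 2 → a - + ∣ b ∣ ≡ q * + 2
  exact 0 _ eq = trans eq (ℤ.+-identityˡ _)
  -- A remainder of 1 would make 2 divide 1.
  exact 1 _ eq = contradiction
    (∣m+n∣n⇒∣m (subst (+ 2 ∣_) eq 2∣a-∣b∣) (divides q refl)) (from-no (+ 2 ∣? + 1))
  exact (suc (suc _)) (s≤s (s≤s ())) _

pairs-card : ∀ {a b} → a ≡₂ b → HasCard (Refinement Pair (IsPair a b)) (S a b)
-- Abstracting the halved difference as `h` leaves it untouched by the case split on the sign of
-- `b`.
pairs-card {a} {b} a≡₂b = go b ((a - + ∣ b ∣) /ℕ 2) (≡₂⇒halvable {a} {b} a≡₂b)
  where
  go : ∀ b h → a ≡ + ∣ b ∣ + h * + 2 →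
    HasCard (Refinement Pair (IsPair a b)) (∑₀ h (choice h ∣ b ∣))
  go (+ β)    h a≡ = ↔-trans (pairs-normalize {h = h} a≡) (normalPairs-card h β)
  -- After the swap the altitude `- -[1+ n ]` computes to `+ suc n`, which is also the absolute
  -- value.
  go -[1+ n ] h a≡ =
    ↔-trans pairs-swap (↔-trans (pairs-normalize {h = h} a≡) (normalPairs-card h (suc n)))

-- Zigzag paths

up down : Bool → Step
up true    = E
up false   = N
down true  = Ē
down false = N̄

-- Together with `Down`, a view of the steps: matching on `direction` leaves two cases, each
-- carrying a letter, instead of four.
data Up : Step → Set where
  up′ : ∀ x → Up (up x)

data Down : Step → Set where
  down′ : ∀ y → Down (down y)

direction : ∀ s → Up s ⊎ Down s
direction E = inj₁ (up′ true)
direction N = inj₁ (up′ false)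
direction Ē = inj₂ (down′ true)
direction N̄ = inj₂ (down′ false)

sign-up : ∀ x → sign (dy (up x)) ≡ Sign.+
sign-up true  = refl
sign-up false = refl

sign-down : ∀ y → sign (dy (down y)) ≡ Sign.-
sign-down true  = refl
sign-down false = refl

startsUp : ∀ x p → StartsUp (up x ∷ p)
startsUp true  _ = inj₁ refl
startsUp false _ = inj₂ refl

startsDown : ∀ y p → StartsDown (down y ∷ p)
startsDown true  _ = inj₁ refl
startsDown false _ = inj₂ refl

¬startsUp-down : ∀ y p → ¬ StartsUp (down y ∷ p)
¬startsUp-down true  _ = λ { (inj₁ ()) ; (inj₂ ()) }
¬startsUp-down false _ = λ { (inj₁ ()) ; (inj₂ ()) }

¬startsDown-up : ∀ x p → ¬ StartsDown (up x ∷ p)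
¬startsDown-up true  _ = λ { (inj₁ ()) ; (inj₂ ()) }
¬startsDown-up false _ = λ { (inj₁ ()) ; (inj₂ ()) }

down-∷⁺ : ∀ y p → StartsUp p → Zigzag p → Zigzag (down y ∷ p)
down-∷⁺ y []      _  _ = [-]
down-∷⁺ y (s ∷ p) up z with direction s
... | inj₁ (up′ x)   = (λ eq → contradiction (trans (sym (sign-down y)) (trans eq (sign-up x))) λ ()) ∷ z
... | inj₂ (down′ x) = contradiction up (¬startsUp-down x p)

up-∷⁺ : ∀ x p → StartsDown p → Zigzag p → Zigzag (up x ∷ p)
up-∷⁺ x []      _    _ = [-]
up-∷⁺ x (s ∷ p) down z with direction s
... | inj₁ (up′ y)   = contradiction down (¬startsDown-up y p)
... | inj₂ (down′ y) = (λ eq → contradiction (trans (sym (sign-up x)) (trans eq (sign-down y))) λ ()) ∷ z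

-- A second down-step would repeat the sign of the first.
down-∷⁻ : ∀ y p → Zigzag (down y ∷ p) → StartsUp p
down-∷⁻ y []      _         = tt
down-∷⁻ y (s ∷ p) (y≢s ∷ _) with direction s
... | inj₁ (up′ x)   = startsUp x p
... | inj₂ (down′ x) = contradiction (trans (sign-down y) (sym (sign-down x))) y≢s

up-∷⁻ : ∀ x p → Zigzag (up x ∷ p) → StartsDown p
up-∷⁻ x []      _         = tt
up-∷⁻ x (s ∷ p) (x≢s ∷ _) with direction s
... | inj₁ (up′ y)   = contradiction (trans (sign-up x) (sym (sign-up y))) x≢s
... | inj₂ (down′ y) = startsDown y p

IsPath IsPath⁺ : ℤ → ℤ → Path → Set
IsPath  n k p = Zigzag p × size p ≡ n × altitude p ≡ k
IsPath⁺ n k p = IsPath n k p × StartsUp p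

-- Weaving two words into a path of even length

-- Junk outside the range of dy.
step : ℤ → Step
step (+ 1)      = E
step (+ _)      = N
step -[1+ 0 ]   = Ē
step -[1+ _ ]   = N̄

step-dy : ∀ s → step (dy s) ≡ s
step-dy N = refl
step-dy N̄ = refl
step-dy E = refl
step-dy Ē = refl

-- `dy` has the left inverse `step`, hence is injective, and equality of integers is decidable.
_≟ˢ_ : DecidableEquality Step
s ≟ˢ t = dec-map (λ eq → trans (sym (step-dy s)) (trans (cong step eq) (step-dy t))) (cong dy)
  (dy s ℤ.≟ dy t)

-- Junk value: the unmatched end of the longer word is dropped.
weave : Word → Word → Path
weave (x ∷ u) (y ∷ v) = up x ∷ down y ∷ weave u v
weave _       _       = []

long : Step → Bool
long N = false
long N̄ = false
long E = true
long Ē = true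

long-up : ∀ x → long (up x) ≡ x
long-up true  = refl
long-up false = refl

long-down : ∀ y → long (down y) ≡ y
long-down true  = refl
long-down false = refl

unweave : Path → Pair
unweave (s ∷ t ∷ p) = let (u , v) = unweave p in long s ∷ u , long t ∷ v
unweave _           = [] , []

unweave-weave : ∀ u v → Balanced (u , v) → unweave (weave u v) ≡ (u , v)
unweave-weave []      []      _   = refl
unweave-weave (x ∷ u) (y ∷ v) bal
  rewrite long-up x | long-down y | unweave-weave u v (ℕ.suc-injective bal) = refl

unweave-balanced : ∀ p → Balanced (unweave p)
unweave-balanced []          = refl
unweave-balanced (_ ∷ [])    = refl
unweave-balanced (_ ∷ _ ∷ p) = cong suc (unweave-balanced p)

weave-startsUp : ∀ u v → StartsUp (weave u v)
weave-startsUp []      _       = tt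
weave-startsUp (_ ∷ _) []      = tt
weave-startsUp (x ∷ u) (y ∷ v) = startsUp x (down y ∷ weave u v)

weave-zigzag : ∀ u v → Zigzag (weave u v)
weave-zigzag []      _       = []
weave-zigzag (_ ∷ _) []      = []
weave-zigzag (x ∷ u) (y ∷ v) =
  up-∷⁺ x _ (startsDown y (weave u v)) (down-∷⁺ y _ (weave-startsUp u v) (weave-zigzag u v))

dx-up : ∀ x → dx (up x) ≡ + 1 + + bit x
dx-up true  = refl
dx-up false = refl

dx-down : ∀ y → dx (down y) ≡ + 1 + + bit y
dx-down true  = refl
dx-down false = refl

dy-up : ∀ x → dy (up x) ≡ + 2 - + bit x
dy-up true  = refl
dy-up false = refl

dy-down : ∀ y → dy (down y) ≡ + bit y - + 2
dy-down true  = refl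
dy-down false = refl

size-weave : ∀ u v → Balanced (u , v) → size (weave u v) ≡ pairSize (u , v)
size-weave []      []      _   = refl
size-weave (x ∷ u) (y ∷ v) bal
  rewrite dx-up x | dx-down y | size-weave u v (ℕ.suc-injective bal) =
  regroup (+ bit x) (+ bit y) (+ length u) (+ trues u) (+ trues v)
  where
  regroup : ∀ x y l s t → + 1 + x + (+ 1 + y + (l * + 2 + (s + t))) ≡
    (+ 1 + l) * + 2 + (x + s + (y + t))
  regroup = solve-∀

altitude-weave : ∀ u v → Balanced (u , v) → altitude (weave u v) ≡ pairAltitude (u , v)
altitude-weave []      []      _   = refl
altitude-weave (x ∷ u) (y ∷ v) bal
  rewrite dy-up x | dy-down y | altitude-weave u v (ℕ.suc-injective bal) =
  regroup (+ bit x) (+ bit y) (+ trues u) (+ trues v)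
  where
  regroup : ∀ x y s t → + 2 - x + (y - + 2 + (t - s)) ≡ y + t - (x + s)
  regroup = solve-∀

-- Induction two steps at a time: zigzag makes each block an up-step followed by a down-step, and
-- parity rules out a single step left over.
weave-unweave : ∀ p → Zigzag p → StartsUp p → size p ≡₂ altitude p → uncurry weave (unweave p) ≡ p
weave-unweave [] _ _ _ = refl
weave-unweave (s ∷ []) _ su even with direction s
... | inj₂ (down′ y)    = contradiction su (¬startsUp-down y [])
-- Size minus altitude of a single step is 1 for `E` and -1 for `N`, both odd.
... | inj₁ (up′ true)   = contradiction (∣ᵤ⇒∣ even) (from-no (+ 2 ∣? + 1))
... | inj₁ (up′ false)  = contradiction (∣ᵤ⇒∣ even) (from-no (+ 2 ∣? -[1+ 0 ]))
weave-unweave (s ∷ t ∷ p) z su even with direction s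
... | inj₂ (down′ y)    = contradiction su (¬startsUp-down y (t ∷ p))
... | inj₁ (up′ x) with direction t
...   | inj₁ (up′ y)   = contradiction (up-∷⁻ x (up y ∷ p) z) (¬startsDown-up y p)
...   | inj₂ (down′ y)
  rewrite long-up x | long-down y =
  cong (λ q → up x ∷ down y ∷ q)
    (weave-unweave p (Linked.tail (Linked.tail z)) (down-∷⁻ y p (Linked.tail z)) (∣⇒∣ᵤ even′))
  where
  difference : ∀ x y m n → + 1 + x + (+ 1 + y + m) - (+ 2 - x + (y - + 2 + n)) ≡
    (m - n) + (+ 1 + x) * + 2
  difference = solve-∀

  -- The removed block contributes `(+ 1 + x) * + 2` to size minus altitude, whatever the down-step
  -- is.
  even′ : + 2 ∣ size p - altitude p
  even′ = ∣m+n∣n⇒∣m {m = size p - altitude p} (subst (+ 2 ∣_)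
    (trans
      (cong₂ _-_
        (cong₂ (λ a b → a + (b + size p)) (dx-up x) (dx-down y))
        (cong₂ (λ a b → a + (b + altitude p)) (dy-up x) (dy-down y)))
      (difference (+ bit x) (+ bit y) (size p) (altitude p)))
    (∣ᵤ⇒∣ even)) (divides (+ 1 + + bit x) refl)

Z⁺↔pairs : ∀ {a b} → a ≡₂ b → Z⁺ a b ↔ Refinement Pair (IsPair a b)
Z⁺↔pairs {a} {b} a≡₂b = refinement-↔ (≡-dec _≟ˢ_) _≟ᴾ_ unweave (uncurry weave) to from wu
  (λ (u , v) (bal , _) → unweave-weave u v bal)
  where
  wu : ∀ p → IsPath⁺ a b p → uncurry weave (unweave p) ≡ p
  wu p ((z , refl , refl) , su) = weave-unweave p z su a≡₂b

  to : ∀ p → IsPath⁺ a b p → IsPair a b (unweave p)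
  -- Size and altitude are computed for woven words, so `p` is first rewritten as the weaving of
  -- `unweave p`.
  to p path@((_ , sz , alt) , _) = bal ,
    trans (sym (size-weave u v bal)) (trans (cong size (wu p path)) sz) ,
    trans (sym (altitude-weave u v bal)) (trans (cong altitude (wu p path)) alt)
    where
    bal = unweave-balanced p
    u = proj₁ (unweave p)
    v = proj₂ (unweave p)

  from : ∀ uv → IsPair a b uv → IsPath⁺ a b (uncurry weave uv)
  from (u , v) (bal , sz , alt) =
    (weave-zigzag u v , trans (size-weave u v bal) sz , trans (altitude-weave u v bal) alt) ,
    weave-startsUp u v

Z⁺-card : ∀ {a b} → a ≡₂ b → HasCard (Z⁺ a b) (S a b)
Z⁺-card {a} {b} a≡₂b = ↔-trans (Z⁺↔pairs {a} {b} a≡₂b) (pairs-card {a} {b} a≡₂b)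

-- Reflection in the horizontal axis

flip : Step → Step
flip N = N̄
flip N̄ = N
flip E = Ē
flip Ē = E

flip-involutive : ∀ s → flip (flip s) ≡ s
flip-involutive N = refl
flip-involutive N̄ = refl
flip-involutive E = refl
flip-involutive Ē = refl

sign-flip : ∀ s → sign (dy (flip s)) ≡ opposite (sign (dy s))
sign-flip N = refl
sign-flip N̄ = refl
sign-flip E = refl
sign-flip Ē = refl

reflect : Path → Path
reflect = map flip

reflect-involutive : ∀ p → reflect (reflect p) ≡ p
reflect-involutive p = trans (sym (map-∘ {g = flip} {f = flip} p)) (trans (map-cong flip-involutive p) (map-id p))

reflect-zigzag : ∀ p → Zigzag p → Zigzag (reflect p)
reflect-zigzag _ = Linked.map⁺ ∘ Linked.map λ {s} {t} s≢t eq →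
  s≢t (Sign.opposite-injective (trans (sym (sign-flip s)) (trans eq (sign-flip t))))

size-reflect : ∀ p → size (reflect p) ≡ size p
size-reflect []      = refl
size-reflect (N ∷ p) = cong (_+_ (+ 1)) (size-reflect p)
size-reflect (N̄ ∷ p) = cong (_+_ (+ 1)) (size-reflect p)
size-reflect (E ∷ p) = cong (_+_ (+ 2)) (size-reflect p)
size-reflect (Ē ∷ p) = cong (_+_ (+ 2)) (size-reflect p)

dy-flip : ∀ s → dy (flip s) ≡ - dy s
dy-flip N = refl
dy-flip N̄ = refl
dy-flip E = refl
dy-flip Ē = refl

altitude-reflect : ∀ p → altitude (reflect p) ≡ - altitude p
altitude-reflect []      = refl
altitude-reflect (s ∷ p) =
  trans (cong₂ _+_ (dy-flip s) (altitude-reflect p)) (sym (ℤ.neg-distrib-+ (dy s) (altitude p)))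

reflect-startsUp : ∀ p → StartsUp p → StartsDown (reflect p)
reflect-startsUp []      _           = tt
reflect-startsUp (_ ∷ _) (inj₁ refl) = inj₁ refl
reflect-startsUp (_ ∷ _) (inj₂ refl) = inj₂ refl

reflect-startsDown : ∀ p → StartsDown p → StartsUp (reflect p)
reflect-startsDown []      _           = tt
reflect-startsDown (_ ∷ _) (inj₁ refl) = inj₁ refl
reflect-startsDown (_ ∷ _) (inj₂ refl) = inj₂ refl

reflect-path : ∀ {a b} p → IsPath a b p → IsPath a (- b) (reflect p)
reflect-path p (z , sz , alt) = reflect-zigzag p z ,
  trans (size-reflect p) sz , trans (altitude-reflect p) (cong -_ alt)

Z⁻↔Z⁺ : ∀ {a b} → Z⁻ a b ↔ Z⁺ a (- b)
Z⁻↔Z⁺ {a} {b} = refinement-↔ (≡-dec _≟ˢ_) (≡-dec _≟ˢ_) reflect reflect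
  (λ { p (path , sd) → reflect-path p path , reflect-startsDown p sd })
  (λ { p (path , su) →
    subst (λ c → IsPath a c (reflect p)) (ℤ.neg-involutive b) (reflect-path p path) ,
    reflect-startsUp p su })
  (λ p _ → reflect-involutive p) (λ p _ → reflect-involutive p)

-- `b` and `- b` differ by the even number `b * + 2`.
≡₂-neg : ∀ {a b} → a ≡₂ b → a ≡₂ - b
≡₂-neg {a} {b} a≡₂b = ∣⇒∣ᵤ (subst (+ 2 ∣_) (identity a b)
  (∣m∣n⇒∣m+n {m = a - b} (∣ᵤ⇒∣ a≡₂b) (divides b refl)))
  where
  identity : ∀ a b → (a - b) + b * + 2 ≡ a - - b
  identity = solve-∀

-- `S` depends on its second argument only through the absolute value.
S-neg : ∀ a b → S a (- b) ≡ S a b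
S-neg a b rewrite ℤ.∣-i∣≡∣i∣ b = refl

Z⁻-card : ∀ {a b} → a ≡₂ b → HasCard (Z⁻ a b) (S a b)
Z⁻-card {a} {b} a≡₂b = subst (HasCard _) (S-neg a b)
  (↔-trans Z⁻↔Z⁺ (Z⁺-card {a} { - b} (≡₂-neg {a} {b} a≡₂b)))

-- Removing the first step

∷-path⁻ : ∀ {n k} s p → IsPath n k (s ∷ p) → IsPath (n - dx s) (k - dy s) p
∷-path⁻ s p (z , refl , refl) =
  Linked.tail z , cancel (dx s) (size p) , cancel (dy s) (altitude p)
  where
  cancel : ∀ x y → y ≡ (x + y) - x
  cancel = solve-∀

∷-path⁺ : ∀ {n k} s p → Zigzag (s ∷ p) → IsPath (n - dx s) (k - dy s) p → IsPath n k (s ∷ p)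
∷-path⁺ {n} {k} s p z (_ , sz , alt) = z ,
  trans (cong (λ x → dx s + x) sz) (cancel (dx s) n) ,
  trans (cong (λ y → dy s + y) alt) (cancel (dy s) k)
  where
  cancel : ∀ x y → x + (y - x) ≡ y
  cancel = solve-∀

¬path-[] : ∀ {n k} → (n , k) ≢ (0ℤ , 0ℤ) → ¬ IsPath n k []
¬path-[] nk≢0 (_ , refl , refl) = nk≢0 refl

-- After `N` or `E` the rest starts downwards or is empty, and `Z⁻` admits both.
Z⁺-first-step : ∀ {n k} → (n , k) ≢ (0ℤ , 0ℤ) →
  Z⁺ n k ↔ (Z⁻ (n - + 1) (k - + 2) ⊎ Z⁻ (n - + 2) (k - + 1))
Z⁺-first-step nk≢0 = mk↔ₛ′
  (λ { ([] , [ path ])     → ⊥-elim-irr (¬path-[] nk≢0 (proj₁ path))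
     ; (N ∷ p , [ path ])  → inj₁ (p , [ ∷-path⁻ N p (proj₁ path) , up-∷⁻ false p (proj₁ (proj₁ path)) ])
     ; (E ∷ p , [ path ])  → inj₂ (p , [ ∷-path⁻ E p (proj₁ path) , up-∷⁻ true p (proj₁ (proj₁ path)) ])
     ; (N̄ ∷ p , [ path ]) → ⊥-elim-irr (¬startsUp-down false p (proj₂ path))
     ; (Ē ∷ p , [ path ]) → ⊥-elim-irr (¬startsUp-down true p (proj₂ path)) })
  (λ { (inj₁ (p , [ path ])) → N ∷ p ,
         [ ∷-path⁺ N p (up-∷⁺ false p (proj₂ path) (proj₁ (proj₁ path))) (proj₁ path) , inj₂ refl ]
     ; (inj₂ (p , [ path ])) → E ∷ p ,
         [ ∷-path⁺ E p (up-∷⁺ true p (proj₂ path) (proj₁ (proj₁ path))) (proj₁ path) , inj₁ refl ] })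
  (λ { (inj₁ _) → refl ; (inj₂ _) → refl })
  (λ { ([] , [ path ])     → ⊥-elim-irr (¬path-[] nk≢0 (proj₁ path))
     ; (N ∷ _ , _)         → refl
     ; (E ∷ _ , _)         → refl
     ; (N̄ ∷ p , [ path ]) → ⊥-elim-irr (¬startsUp-down false p (proj₂ path))
     ; (Ē ∷ p , [ path ]) → ⊥-elim-irr (¬startsUp-down true p (proj₂ path)) })

-- The mirror image: `k - dy N̄` and `k - dy Ē` compute to `k + + 2` and `k + + 1`.
Z⁻-first-step : ∀ {n k} → (n , k) ≢ (0ℤ , 0ℤ) →
  Z⁻ n k ↔ (Z⁺ (n - + 1) (k + + 2) ⊎ Z⁺ (n - + 2) (k + + 1))
Z⁻-first-step nk≢0 = mk↔ₛ′
  (λ { ([] , [ path ])     → ⊥-elim-irr (¬path-[] nk≢0 (proj₁ path))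
     ; (N̄ ∷ p , [ path ]) → inj₁ (p , [ ∷-path⁻ N̄ p (proj₁ path) , down-∷⁻ false p (proj₁ (proj₁ path)) ])
     ; (Ē ∷ p , [ path ]) → inj₂ (p , [ ∷-path⁻ Ē p (proj₁ path) , down-∷⁻ true p (proj₁ (proj₁ path)) ])
     ; (N ∷ p , [ path ])  → ⊥-elim-irr (¬startsDown-up false p (proj₂ path))
     ; (E ∷ p , [ path ])  → ⊥-elim-irr (¬startsDown-up true p (proj₂ path)) })
  (λ { (inj₁ (p , [ path ])) → N̄ ∷ p ,
         [ ∷-path⁺ N̄ p (down-∷⁺ false p (proj₂ path) (proj₁ (proj₁ path))) (proj₁ path) , inj₂ refl ]
     ; (inj₂ (p , [ path ])) → Ē ∷ p ,
         [ ∷-path⁺ Ē p (down-∷⁺ true p (proj₂ path) (proj₁ (proj₁ path))) (proj₁ path) , inj₁ refl ] })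
  (λ { (inj₁ _) → refl ; (inj₂ _) → refl })
  (λ { ([] , [ path ])     → ⊥-elim-irr (¬path-[] nk≢0 (proj₁ path))
     ; (N̄ ∷ _ , _)        → refl
     ; (Ē ∷ _ , _)        → refl
     ; (N ∷ p , [ path ])  → ⊥-elim-irr (¬startsDown-up false p (proj₂ path))
     ; (E ∷ p , [ path ])  → ⊥-elim-irr (¬startsDown-up true p (proj₂ path)) })

-- Only the empty path lies in both parts, and it ends at the excluded point.
Z↔Z⁺⊎Z⁻ : ∀ {n k} → (n , k) ≢ (0ℤ , 0ℤ) → Z n k ↔ (Z⁺ n k ⊎ Z⁻ n k)
Z↔Z⁺⊎Z⁻ nk≢0 = mk↔ₛ′
  (λ { ([] , [ path ])     → ⊥-elim-irr (¬path-[] nk≢0 path)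
     ; (N ∷ p , [ path ])  → inj₁ (N ∷ p , [ path , inj₂ refl ])
     ; (E ∷ p , [ path ])  → inj₁ (E ∷ p , [ path , inj₁ refl ])
     ; (N̄ ∷ p , [ path ]) → inj₂ (N̄ ∷ p , [ path , inj₂ refl ])
     ; (Ē ∷ p , [ path ]) → inj₂ (Ē ∷ p , [ path , inj₁ refl ]) })
  (λ { (inj₁ (p , [ path ])) → p , [ proj₁ path ]
     ; (inj₂ (p , [ path ])) → p , [ proj₁ path ] })
  (λ { (inj₁ ([] , [ path ]))     → ⊥-elim-irr (¬path-[] nk≢0 (proj₁ path))
     ; (inj₁ (N ∷ _ , _))         → refl
     ; (inj₁ (E ∷ _ , _))         → refl
     ; (inj₁ (N̄ ∷ p , [ path ])) → ⊥-elim-irr (¬startsUp-down false p (proj₂ path))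
     ; (inj₁ (Ē ∷ p , [ path ])) → ⊥-elim-irr (¬startsUp-down true p (proj₂ path))
     ; (inj₂ ([] , [ path ]))     → ⊥-elim-irr (¬path-[] nk≢0 (proj₁ path))
     ; (inj₂ (N̄ ∷ _ , _))        → refl
     ; (inj₂ (Ē ∷ _ , _))        → refl
     ; (inj₂ (N ∷ p , [ path ]))  → ⊥-elim-irr (¬startsDown-up false p (proj₂ path))
     ; (inj₂ (E ∷ p , [ path ]))  → ⊥-elim-irr (¬startsDown-up true p (proj₂ path)) })
  (λ { ([] , [ path ]) → ⊥-elim-irr (¬path-[] nk≢0 path)
     ; (N ∷ _ , _) → refl
     ; (E ∷ _ , _) → refl
     ; (N̄ ∷ _ , _) → refl
     ; (Ē ∷ _ , _) → refl })

-- Parity after removing a step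

odd⇒2∣+1 : ∀ i → ¬ + 2 ∣ i → + 2 ∣ i + + 1
odd⇒2∣+1 i odd with i %ℕ 2 | i /ℕ 2 | a≡a%ℕn+[a/ℕn]*n i 2 | n%ℕd<d i 2
... | 0           | q | eq | _ = contradiction (divides q (trans eq (ℤ.+-identityˡ _))) odd
... | 1           | q | eq | _ = divides (q + + 1) (trans (cong (_+ + 1) eq) (regroup q))
  where
  regroup : ∀ q → + 1 + q * + 2 + + 1 ≡ (q + + 1) * + 2
  regroup = solve-∀
... | suc (suc _) | _ | _  | s≤s (s≤s ())

-- With `c` and `d` the components of a step, the new difference is the sum of the even numbers
-- `n - k + + 1` and `d - c - + 1`.
shift-parity : ∀ {n k} c d → ¬ n ≡₂ k → + 2 ∣ d - c - + 1 → n - c ≡₂ k - d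
shift-parity {n} {k} c d n≢₂k 2∣shift = ∣⇒∣ᵤ (subst (+ 2 ∣_) (regroup n k c d)
  (∣m∣n⇒∣m+n (odd⇒2∣+1 (n - k) (n≢₂k ∘ ∣⇒∣ᵤ)) 2∣shift))
  where
  regroup : ∀ n k c d → n - k + + 1 + (d - c - + 1) ≡ (n - c) - (k - d)
  regroup = solve-∀

-- A path starting upwards continues downwards after its first step, whereas the
-- theorem counts by paths starting upwards; in even length both are equinumerous.
Z⁻↔Z⁺-even : ∀ {a b} → a ≡₂ b → Z⁻ a b ↔ Z⁺ a b
Z⁻↔Z⁺-even {a} {b} a≡₂b = ↔-trans (Z⁻-card {a} {b} a≡₂b) (↔-sym (Z⁺-card {a} {b} a≡₂b))

theorem3p2 : (n k : ℤ) → 0ℤ ≤ n →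
    (n ≡₂ k → (n , k) ≢ (0ℤ , 0ℤ) → HasCard (Z n k) (2 ℕ.* S n k))
    ×
    (¬ (n ≡₂ k) →
    (∀ p q r s →
    HasCard (Z⁺ (n - + 1) (k - + 2)) p →
    HasCard (Z⁺ (n - + 2) (k - + 1)) q →
    HasCard (Z⁻ (n - + 1) (k + + 2)) r →
    HasCard (Z⁻ (n - + 2) (k + + 1)) s →
    HasCard (Z n k) (p ℕ.+ q ℕ.+ r ℕ.+ s))
    × HasCard (Z⁺ (n - + 1) (k - + 2)) (S (n - + 1) (k - + 2))
    × HasCard (Z⁺ (n - + 2) (k - + 1)) (S (n - + 2) (k - + 1))
    × HasCard (Z⁻ (n - + 1) (k + + 2)) (S (n - + 1) (k + + 2))
    × HasCard (Z⁻ (n - + 2) (k + + 1)) (S (n - + 2) (k + + 1)))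
theorem3p2 n k _ = even , odd
  where
  even : n ≡₂ k → (n , k) ≢ (0ℤ , 0ℤ) → HasCard (Z n k) (2 ℕ.* S n k)
  even n≡₂k nk≢0 = subst (HasCard (Z n k)) (cong (S n k ℕ.+_) (sym (ℕ.+-identityʳ (S n k))))
    (↔-trans (Z↔Z⁺⊎Z⁻ nk≢0) (⊎-card (Z⁺-card {n} {k} n≡₂k) (Z⁻-card {n} {k} n≡₂k)))

  odd : ¬ n ≡₂ k → _
  odd n≢₂k =
    (λ p q r s Z⁺₁ Z⁺₂ Z⁻₁ Z⁻₂ →
      subst (HasCard (Z n k)) (sym (ℕ.+-assoc (p ℕ.+ q) r s))
        (↔-trans (Z↔Z⁺⊎Z⁻ nk≢0)
          (⊎-card
            (↔-trans (Z⁺-first-step nk≢0) (⊎-card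
              (↔-trans (Z⁻↔Z⁺-even {n - + 1} {k - + 2} N-parity) Z⁺₁)
              (↔-trans (Z⁻↔Z⁺-even {n - + 2} {k - + 1} E-parity) Z⁺₂)))
            (↔-trans (Z⁻-first-step nk≢0) (⊎-card
              -- Removing a down-step leads to `Z⁺`, so here the exchange runs in the other
              -- direction.
              (↔-trans (↔-sym (Z⁻↔Z⁺-even {n - + 1} {k + + 2} N̄-parity)) Z⁻₁)
              (↔-trans (↔-sym (Z⁻↔Z⁺-even {n - + 2} {k + + 1} Ē-parity)) Z⁻₂)))))) ,
    Z⁺-card {n - + 1} {k - + 2} N-parity ,
    Z⁺-card {n - + 2} {k - + 1} E-parity ,
    Z⁻-card {n - + 1} {k + + 2} N̄-parity ,
    Z⁻-card {n - + 2} {k + + 1} Ē-parity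
    where
    nk≢0 : (n , k) ≢ (0ℤ , 0ℤ)
    -- At the origin `n` and `k` would have the same parity.
    nk≢0 refl = n≢₂k (∣⇒∣ᵤ {+ 2} (divides 0ℤ refl))

    N-parity : n - + 1 ≡₂ k - + 2
    -- The even integers tested here and below are the values of `dy s - dx s - + 1`, namely 0, -2,
    -- -4 and -4.
    N-parity = shift-parity {n} {k} (dx N) (dy N) n≢₂k (from-yes (+ 2 ∣? 0ℤ))

    E-parity : n - + 2 ≡₂ k - + 1
    E-parity = shift-parity {n} {k} (dx E) (dy E) n≢₂k (from-yes (+ 2 ∣? -[1+ 1 ]))

    N̄-parity : n - + 1 ≡₂ k + + 2
    N̄-parity = shift-parity {n} {k} (dx N̄) (dy N̄) n≢₂k (from-yes (+ 2 ∣? -[1+ 3 ]))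

    Ē-parity : n - + 2 ≡₂ k + + 1
    Ē-parity = shift-parity {n} {k} (dx Ē) (dy Ē) n≢₂k (from-yes (+ 2 ∣? -[1+ 3 ]))
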